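{- Let $\mathfrak{R}=(D,\mathcal{M},\pi)$ be a matroid-rooted digraph with $D=(V,A)$, $\mathcal{M}=(S,\mathcal{I})$, let $t\in V$, let $T$ be the $\subseteq$-largest $t$-good set, and let $\mathcal{P}=\{P_i\}_{i\in I}$ be an $(I,\{t\})$-linkage (with $I\in\mathcal{I}$). If $\mathcal{P}$ and $T$ do not satisfy the complementarity conditions, then there is a $\{t\}$-linkable $I'\in\mathcal{I}$ with $\mathsf{span}(I')\supsetneq\mathsf{span}(I)$.
   Context: Matroids may be infinite (axioms of Bruhn et al.); $\mathsf{span}$ is the closure operator; a base of $S'\subseteq S$ is a base of the restriction to $S'$. Paths are finite directed paths without repeated vertices. A matroid-rooted digraph is $(D,\mathcal{M},\pi)$ with $D=(V,A)$ a digraph (parallel edges allowed, no loops), $\mathcal{M}=(S,\mathcal{I})$ a matroid, $\pi:S\to\mathcal{P}(V)\setminus\{\varnothing\}$. For $X\subseteq V$, $\mathcal{S}(X)=\{i\in S:\pi(i)\cap X\ne\varnothing\}$, $\mathsf{in}_D(X)$ is the set of edges entering $X$, $D[X]$ the induced subdigraph. For $I\in\mathcal{I}$ and $Y\subseteq V$ an $(I,Y)$-linkage is a family of pairwise edge-disjoint paths $\{P_i\}_{i\in I}$ with $P_i$ from a vertex of $\pi(i)$ to a vertex of $Y$; $I$ is $Y$-linkable if one exists. A set $X\subseteq V$ is $t$-good if there is a system of pairwise edge-disjoint paths $\{P_b\}_{b\in B}\cup\{P_e\}_{e\in\mathsf{in}_D(X)}$ in $D[X]$ with $B$ a base of $\mathcal{S}(X)$,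 $P_b$ from $\pi(b)$ to $t$, $P_e$ from $\mathsf{head}(e)$ to $t$; a $\subseteq$-largest $t$-good set exists. The complementarity conditions for an $(I,\{t\})$-linkage $\{P_i\}_{i\in I}$ and a vertex set $X\ni t$ are: (1) $I_{in}:=I\cap\mathcal{S}(X)$ is a base of $\mathcal{S}(X)$; (2) the paths $P_i$, $i\in I_{in}$, lie in $D[X]$; (3) for $i\in I_{out}:=I\setminus\mathcal{S}(X)$ we have $|A(P_i)\cap\mathsf{in}_D(X)|=1$; (4) $\bigcup_{i\in I_{out}}A(P_i)\supseteq\mathsf{in}_D(X)$. -}

module Defs where

open import Level using (0ℓ)
import Level
open import Data.Empty using (⊥)
open import Data.Unit using (⊤)
open import Data.Product using (Σ; ∃; _×_; _,_)
open import Data.Sum using (_⊎_)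
open import Data.List using (List; []; _∷_)
open import Data.List.Membership.Propositional using (_∈_)
open import Data.List.Relation.Unary.All using (All)
open import Data.List.Relation.Unary.Unique.Propositional using (Unique)
open import Relation.Nullary using (¬_)
open import Relation.Unary using (Pred; _⊆_; _∪_; ｛_｝; ∅; _∩_)
open import Relation.Binary.PropositionalEquality using (_≡_; _≢_)

-- (Possibly infinite) matroids, independence axioms of Bruhn et al.
-- Subsets of the ground set S are predicates  Pred S 0ℓ.

module _ {S : Set} (Indep : Pred S 0ℓ → Set) where

  IsMaxIndepIn : Pred S 0ℓ → Pred S 0ℓ → Set₁
  IsMaxIndepIn X B =
    B ⊆ X × Indep B × (∀ J → Indep J → B ⊆ J → J ⊆ X → J ⊆ B)

record Matroid (S : Set) : Set₁ where
  field
    Indep : Pred S 0ℓ → Set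
    indep-∅ : Indep ∅
    indep-⊆ : ∀ I J → J ⊆ I → Indep I → Indep J
    indep-aug : ∀ I I' → Indep I → ¬ IsMaxIndepIn Indep (λ _ → ⊤) I →
                IsMaxIndepIn Indep (λ _ → ⊤) I' →
                ∃ λ x → I' x × ¬ I x × Indep (I ∪ ｛ x ｝)
    indep-max : ∀ I X → Indep I → I ⊆ X →
                ∃ λ J → I ⊆ J × IsMaxIndepIn Indep X J

  IsBaseOf : Pred S 0ℓ → Pred S 0ℓ → Set₁
  IsBaseOf S' B = IsMaxIndepIn Indep S' B

  span : Pred S 0ℓ → Pred S (Level.suc 0ℓ)
  span X x = X x ⊎ (∃ λ J → J ⊆ X × Indep J × ¬ Indep (J ∪ ｛ x ｝))

record Digraph : Set₁ where
  field
    V : Set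
    A : Set
    tail : A → V
    head : A → V
    noLoop : ∀ a → tail a ≢ head a

  inD : Pred V 0ℓ → Pred A 0ℓ
  inD X a = ¬ X (tail a) × X (head a)

  Chain : V → List A → Set
  Chain v [] = ⊤
  Chain v (a ∷ as) = tail a ≡ v × Chain (head a) as

  verts : V → List A → List V
  verts v [] = v ∷ []
  verts v (a ∷ as) = v ∷ verts (head a) as

  endV : V → List A → V
  endV v [] = v
  endV v (a ∷ as) = endV (head a) as

  record Path : Set where
    field
      start : V
      edges : List A
      chain : Chain start edges
      simple : Unique (verts start edges)

    vertices : List V
    vertices = verts start edges

    end : V
    end = endV start edges

  open Path public

  EdgeOf : Path → Pred A 0ℓ
  EdgeOf p a = a ∈ edges p

  EdgeDisjoint : Path → Path → Set
  EdgeDisjoint p q = ∀ a → a ∈ edges p → a ∈ edges q → ⊥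

  InInduced : Pred V 0ℓ → Path → Set
  InInduced X p = All X (vertices p)

record MatroidRootedDigraph : Set₁ where
  field
    D : Digraph
  open Digraph D public
  field
    S : Set
    M : Matroid S
    π : S → Pred V 0ℓ
    π-nonempty : ∀ i → ∃ λ v → π i v
  open Matroid M public

  𝒮 : Pred V 0ℓ → Pred S 0ℓ
  𝒮 X i = ∃ λ v → π i v × X v

  -- (I,Y)-linkage {P_i}_{i∈I}: the family is given as P : S → Path,
  -- only the values at i ∈ I are relevant
  IsLinkage : Pred S 0ℓ → Pred V 0ℓ → (S → Path) → Set
  IsLinkage I Y P =
    (∀ i → I i → π i (start (P i)) × Y (end (P i))) ×
    (∀ i j → I i → I j → i ≢ j → EdgeDisjoint (P i) (P j))

  Linkage : Pred S 0ℓ → Pred V 0ℓ → Set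
  Linkage I Y = Σ (S → Path) (IsLinkage I Y)

  Linkable : Pred S 0ℓ → Pred V 0ℓ → Set
  Linkable I Y = Linkage I Y

  Good : V → Pred V 0ℓ → Set₁
  Good t X =
    Σ (Pred S 0ℓ) λ B → IsBaseOf (𝒮 X) B ×
    Σ (S → Path) λ Pb → Σ (A → Path) λ Pe →
      (∀ b → B b → π b (start (Pb b)) × end (Pb b) ≡ t × InInduced X (Pb b)) ×
      (∀ e → inD X e → start (Pe e) ≡ head e × end (Pe e) ≡ t × InInduced X (Pe e)) ×
      (∀ b b' → B b → B b' → b ≢ b' → EdgeDisjoint (Pb b) (Pb b')) ×
      (∀ e e' → inD X e → inD X e' → e ≢ e' → EdgeDisjoint (Pe e) (Pe e')) ×
      (∀ b e → B b → inD X e → EdgeDisjoint (Pb b) (Pe e))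

  IsLargestGood : V → Pred V 0ℓ → Set₁
  IsLargestGood t T = Good t T × (∀ X → Good t X → X ⊆ T)

  Complementarity : Pred S 0ℓ → (S → Path) → Pred V 0ℓ → Set₁
  Complementarity I P X =
    IsBaseOf (𝒮 X) (I ∩ 𝒮 X) ×
    (∀ i → I i → 𝒮 X i → InInduced X (P i)) ×
    (∀ i → I i → ¬ 𝒮 X i →
       ∃ λ a → a ∈ edges (P i) × inD X a ×
         (∀ a' → a' ∈ edges (P i) → inD X a' → a' ≡ a)) ×
    (∀ e → inD X e → ∃ λ i → I i × ¬ 𝒮 X i × e ∈ edges (P i))

{-# OPTIONS --safe #-}
module Submission where

-- Let B, P_b, P_e witness that T is good.  Follow each P_i that starts outside T to its first
-- edge e into T and continue along P_e; together with the paths P_b this links a base I'' of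
-- B ∪ (I ∖ 𝒮 T), and span I ⊆ span I''.  If span I'' = span I and every edge into T is used
-- by the new linkage, then P and T satisfy the complementarity conditions.
-- Otherwise some edge e₀ into T is unused, and e₀ followed by P_{e₀} is an extra trail to t
-- disjoint from the linkage.  Such a pair (linkage, extra trail) is transformed by moving the
-- source of the extra trail backwards along an unused edge or forwards along a used one, or by
-- a matroid exchange; every intermediate pair is again valid, so augmenting paths need not be
-- chosen shortest.  Either the source becomes a root of an element outside the span of the
-- linkage, which can then be added, or the set Z of all sources that occur is good.  The
-- latter is impossible: Z contains tail e₀, which lies outside the largest good set T.

open import Defs
open import Level using (0ℓ; suc; lift; lower)
open import Axiom.ExcludedMiddle using (ExcludedMiddle)
open import Data.Empty using (⊥; ⊥-elim)
open import Data.Unit using (⊤; tt)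
open import Data.Product using (Σ; ∃; _×_; _,_; proj₁; proj₂)
open import Data.Sum using (_⊎_; inj₁; inj₂; [_,_]; [_,_]′)
open import Data.List using (List; []; _∷_; _++_)
open import Data.List.Properties using (++-assoc)
open import Data.List.Membership.Propositional using (_∈_)
open import Data.List.Membership.Propositional.Properties using (∈-++⁺ˡ; ∈-++⁺ʳ; ∈-++⁻; ∈-∃++)
open import Data.List.Relation.Unary.Any using (here; there)
open import Data.List.Relation.Unary.All as All using (All; []; _∷_)
import Data.List.Relation.Unary.All.Properties as All
open import Data.List.Relation.Unary.AllPairs using ([]; _∷_)
open import Data.List.Relation.Unary.Unique.Propositional using (Unique)
open import Data.List.Relation.Unary.Unique.Propositional.Properties using (++⁺)
open import Data.List.Relation.Binary.Disjoint.Propositional using (Disjoint)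
open import Function using (_∘_; id; case_of_)
open import Relation.Nullary using (¬_; Dec; yes; no; contradiction)
open import Relation.Nullary.Decidable using (map′; decidable-stable; True; toWitness; fromWitness)
open import Relation.Unary using (Pred; ｛_｝; _⊂_; _⊆_; _∪_; _∩_; _∖_; ∅)
open import Relation.Binary.PropositionalEquality using (_≡_; _≢_; refl; sym; trans; cong; subst)

em₀ : ExcludedMiddle (suc 0ℓ) → ExcludedMiddle 0ℓ
em₀ em = map′ lower lift em

-- Matroids: augmentation inside a set, span and exchange.

module MatroidLemmas (em : ExcludedMiddle (suc 0ℓ)) {S : Set} (M : Matroid S) where
  open Matroid M

  dec : ExcludedMiddle 0ℓ
  dec = em₀ em

  ¬max⇒extendable : ∀ X I → Indep I → I ⊆ X → ¬ IsBaseOf X I →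
                    ∃ λ y → X y × ¬ I y × Indep (I ∪ ｛ y ｝)
  ¬max⇒extendable X I ind I⊆X ¬max with dec {∃ λ y → X y × ¬ I y × Indep (I ∪ ｛ y ｝)}
  ... | yes p = p
  ... | no ¬p = ⊥-elim (¬max (I⊆X , ind , λ J indJ I⊆J J⊆X {j} Jj →
    decidable-stable dec λ ¬Ij → ¬p (j , J⊆X Jj , ¬Ij ,
      indep-⊆ J _ [ I⊆J , (λ { refl → Jj }) ] indJ)))

  -- A base `J` of `I ∪ B` above `I` works: if it were not a base of the whole matroid, it could be
  -- augmented by an element of `B`, which would stay inside `I ∪ B`.
  extend-within : ∀ I B → Indep I → IsBaseOf (λ _ → ⊤) B →
                  ∃ λ J → I ⊆ J × J ⊆ I ∪ B × IsBaseOf (λ _ → ⊤) J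
  extend-within I B indI maxB =
    let J , I⊆J , J⊆ , indJ , maxJ = indep-max I (I ∪ B) indI inj₁ in
    J , I⊆J , J⊆ , decidable-stable em λ ¬base →
      let x , Bx , ¬Jx , ind = indep-aug J B indJ ¬base maxB in
      ¬Jx (maxJ _ ind inj₁ [ J⊆ , (λ { refl → inj₂ Bx }) ] (inj₂ refl))

  -- Augmentation inside X, reduced to the global axiom by extending I' to a base B' of the
  -- whole matroid: if I could not be augmented from I', then a base K of I ∪ ｛ y ｝ ∪ B' would
  -- contain B' ∖ X, and hence properly contain a base J of I ∪ B'.
  aug-within : ∀ X I I' → Indep I → I ⊆ X → ¬ IsBaseOf X I → IsBaseOf X I' →
               ∃ λ x → I' x × ¬ I x × Indep (I ∪ ｛ x ｝)
  aug-within X I I' indI I⊆X ¬max (I'⊆X , indI' , maxI') = decidable-stable dec absurd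
    where
    absurd : ¬ ¬ ∃ λ x → I' x × ¬ I x × Indep (I ∪ ｛ x ｝)
    absurd none
      with y , Xy , ¬Iy , indIy ← ¬max⇒extendable X I indI I⊆X ¬max
      with B' , I'⊆B' , baseB'@(_ , indB' , _) ← indep-max I' (λ _ → ⊤) indI' (λ _ → tt)
      with J , I⊆J , J⊆ , (_ , indJ , maxJ) ← extend-within I B' indI baseB'
      with K , Iy⊆K , K⊆ , baseK@(_ , indK , _) ← extend-within (I ∪ ｛ y ｝) B' indIy baseB'
      = ¬Iy ([ id , (λ B'y → ⊥-elim (none (y , B'∩X⊆I' Xy B'y , ¬Iy , indIy))) ]
             (J⊆ (maxJ K indK J⊆K (λ _ → tt) (Iy⊆K (inj₂ refl)))))
      where
      B'∩X⊆I' : ∀ {x} → X x → B' x → I' x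
      B'∩X⊆I' Xx B'x = maxI' (B' ∩ X) (indep-⊆ B' _ proj₁ indB')
        (λ I'z → I'⊆B' I'z , I'⊆X I'z) proj₂ (B'x , Xx)

      K∖X⊆B' : K ∖ X ⊆ B'
      K∖X⊆B' (Kx , ¬Xx) with K⊆ Kx
      ... | inj₁ (inj₁ Ix) = ⊥-elim (¬Xx (I⊆X Ix))
      ... | inj₁ (inj₂ refl) = ⊥-elim (¬Xx Xy)
      ... | inj₂ B'x = B'x

      -- The set made of `I'` and the part of `K` outside `X` lies in `B'`. If it missed `z`, it
      -- could be augmented from `K`, necessarily by an element of `X`, against the maximality of
      -- `I'` in `X`.
      B'∖X⊆K : B' ∖ X ⊆ K
      B'∖X⊆K {z} (B'z , ¬Xz) = decidable-stable dec λ ¬Kz →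
        let N⊆B' = λ {z} → [ I'⊆B' , K∖X⊆B' {z} ]
            ¬baseN = λ baseN → [ ¬Xz ∘ I'⊆X , ¬Kz ∘ proj₁ ]
                       (proj₂ (proj₂ baseN) B' indB' N⊆B' (λ _ → tt) B'z)
            x , Kx , ¬Nx , ind = indep-aug (I' ∪ (K ∖ X)) K (indep-⊆ B' _ N⊆B' indB') ¬baseN baseK
            Xx = decidable-stable dec λ ¬Xx → ¬Nx (inj₂ (Kx , ¬Xx))
        in ¬Nx (inj₁ (maxI' (I' ∪ ｛ x ｝) (indep-⊆ _ _ [ inj₁ ∘ inj₁ , inj₂ ] ind) inj₁
             [ I'⊆X , (λ { refl → Xx }) ] (inj₂ refl)))

      J⊆K : J ⊆ K
      J⊆K {x} Jx with J⊆ Jx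
      ... | inj₁ Ix = Iy⊆K (inj₁ Ix)
      ... | inj₂ B'x with dec {X x} | dec {I x}
      ...   | no ¬Xx | _ = B'∖X⊆K (B'x , ¬Xx)
      ...   | yes _ | yes Ix = Iy⊆K (inj₁ Ix)
      ...   | yes Xx | no ¬Ix = ⊥-elim (none (x , B'∩X⊆I' Xx B'x , ¬Ix ,
        indep-⊆ J _ [ I⊆J , (λ { refl → Jx }) ] indJ))

  span-mono : ∀ {X Y} → X ⊆ Y → span X ⊆ span Y
  span-mono X⊆Y (inj₁ Xx) = inj₁ (X⊆Y Xx)
  span-mono X⊆Y (inj₂ (J , J⊆X , rest)) = inj₂ (J , X⊆Y ∘ J⊆X , rest)

  dep⇒span : ∀ {I x} → Indep I → ¬ Indep (I ∪ ｛ x ｝) → span I x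
  dep⇒span {I} indI ¬ind = inj₂ (I , id , indI , ¬ind)

  base-spans : ∀ {X B} → IsBaseOf X B → X ⊆ span B
  base-spans {X} {B} (B⊆X , indB , maxB) {x} Xx with dec {B x}
  ... | yes Bx = inj₁ Bx
  ... | no ¬Bx = dep⇒span indB (λ ind →
    ¬Bx (maxB _ ind inj₁ [ B⊆X , (λ { refl → Xx }) ] (inj₂ refl)))

  -- Let `x` outside `X` be spanned by `J`, and extend `J` to a base `J*` of `X`, which is then also
  -- a base of `X ∪ ｛ x ｝`. If `B ∪ ｛ x ｝` were independent, `B` would not be such a base, and
  -- augmenting it from `J*` would enlarge it inside `X`.
  span-of-base : ∀ {X B} → IsBaseOf X B → span X ⊆ span B
  span-of-base baseB (inj₁ Xx) = base-spans baseB Xx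
  span-of-base {X} {B} baseB@(B⊆X , indB , maxB) {x} (inj₂ (J , J⊆X , indJ , ¬indJx))
    with dec {X x}
  ... | yes Xx = base-spans baseB Xx
  ... | no ¬Xx = dep⇒span indB (λ indBx →
    let J* , J⊆J* , J*⊆X , indJ* , maxJ* = indep-max J X indJ J⊆X
        maxJ*' : ∀ L → Indep L → J* ⊆ L → L ⊆ X ∪ ｛ x ｝ → L ⊆ J*
        maxJ*' = λ L indL J*⊆L L⊆ → maxJ* L indL J*⊆L (λ Lz →
          [ id , (λ { refl → ⊥-elim (¬indJx (indep-⊆ L _ [ J*⊆L ∘ J⊆J* , (λ { refl → Lz }) ] indL)) }) ]
          (L⊆ Lz))
        ¬maxB = λ maxB' → ¬Xx (B⊆X (proj₂ (proj₂ maxB') _ indBx inj₁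
          [ inj₁ ∘ B⊆X , inj₂ ] (inj₂ refl)))
        y , J*y , ¬By , indBy = aug-within (X ∪ ｛ x ｝) B J* indB (inj₁ ∘ B⊆X) ¬maxB
          (inj₁ ∘ J*⊆X , indJ* , maxJ*')
    in ¬By (maxB _ indBy inj₁ [ B⊆X , (λ { refl → J*⊆X J*y }) ] (inj₂ refl)))

  span-∩-indep : ∀ {I J x} → Indep J → I ⊆ J → J x → span I x → I x
  span-∩-indep indJ I⊆J Jx (inj₁ Ix) = Ix
  span-∩-indep indJ I⊆J Jx (inj₂ (L , L⊆I , _ , ¬ind)) =
    ⊥-elim (¬ind (indep-⊆ _ _ [ I⊆J ∘ L⊆I , (λ { refl → Jx }) ] indJ))

  -- `I` is a base of `I ∪ K`, so `span-of-base` applies.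
  span-closed : ∀ {I K} → Indep I → K ⊆ span I → span K ⊆ span I
  span-closed {I} {K} indI K⊆ = span-of-base
    (inj₁ , indI , λ J indJ I⊆J J⊆ {j} Jj →
      span-∩-indep indJ I⊆J Jj ([ inj₁ , K⊆ ] (J⊆ Jj))) ∘ span-mono inj₂

  -- Only `i` itself needs an argument: if adding it back kept independence, `I ∪ ｛ s ｝` would be
  -- independent.
  exchange-spans : ∀ {I s i} → Indep ((I ∖ ｛ i ｝) ∪ ｛ s ｝) → ¬ Indep (I ∪ ｛ s ｝) →
                   I ⊆ span ((I ∖ ｛ i ｝) ∪ ｛ s ｝)
  exchange-spans {I} {s} {i} ind dep {x} Ix with dec {i ≡ x}
  ... | no i≢x = inj₁ (inj₁ (Ix , i≢x))
  ... | yes refl = dep⇒span ind λ ind' → dep (indep-⊆ _ _ sub ind')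
    where
    sub : I ∪ ｛ s ｝ ⊆ ((I ∖ ｛ i ｝) ∪ ｛ s ｝) ∪ ｛ i ｝
    sub (inj₂ eq) = inj₁ (inj₂ eq)
    sub {y} (inj₁ Iy) with dec {i ≡ y}
    ... | yes eq = inj₂ eq
    ... | no neq = inj₁ (inj₁ (Iy , neq))

  -- The displayed set is the fundamental circuit of `s` with respect to `I`. If it were
  -- independent, a base `J` of `I ∪ ｛ s ｝` above it would miss some `x` of `I`. Such an `x` is not
  -- exchangeable for `s`, so `I` without `x` spans `s`, hence `J`, hence `x`.
  fundamental-circuit : ∀ {I s} → Indep I → ¬ Indep (I ∪ ｛ s ｝) →
    ¬ Indep ((λ i → I i × Indep ((I ∖ ｛ i ｝) ∪ ｛ s ｝)) ∪ ｛ s ｝)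
  fundamental-circuit {I} {s} indI dep indC =
    let J , C⊆J , J⊆ , indJ , maxJ = indep-max _ (I ∪ ｛ s ｝) indC [ inj₁ ∘ proj₁ , inj₂ ]
        J⊉I : ¬ (I ⊆ J)
        J⊉I = λ I⊆J → dep (indep-⊆ _ _ [ I⊆J , C⊆J ∘ inj₂ ] indJ)
    in J⊉I λ {x} Ix → decidable-stable dec λ ¬Jx →
      let I∖x-ind = indep-⊆ I (I ∖ ｛ x ｝) proj₁ indI
          ¬indx = λ ind → ¬Jx (C⊆J (inj₁ (Ix , ind)))
          J⊆span : J ⊆ span (I ∖ ｛ x ｝)
          J⊆span = λ {j} Jj → [ (λ Ij → inj₁ (Ij , λ { refl → ¬Jx Jj }))
                              , (λ { refl → dep⇒span I∖x-ind ¬indx }) ] (J⊆ Jj)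
          x∈span = span-closed I∖x-ind J⊆span (base-spans (J⊆ , indJ , maxJ) (inj₁ Ix))
      in proj₂ (span-∩-indep indI proj₁ Ix x∈span) refl

-- Choice and lists.

choose : ExcludedMiddle 0ℓ → {X Y : Set} {Q : Pred X 0ℓ} {R : X → Y → Set} → Y →
         (∀ x → Q x → ∃ (R x)) → ∃ λ (f : X → Y) → ∀ x → Q x → R x (f x)
choose dec {X} {Y} {Q} {R} default g = (λ x → proj₁ (pick x)) , λ x → proj₂ (pick x)
  where
  pick : ∀ x → ∃ λ y → Q x → R x y
  pick x with dec {Q x}
  ... | yes q = let y , r = g x q in y , λ _ → r
  -- Off `Q` the value is unconstrained, so a default makes the function total.
  ... | no ¬q = default , λ q → contradiction q ¬q

unique-++⁻ : ∀ {A : Set} (p : List A) {q} → Unique (p ++ q) → Unique p × Unique q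
unique-++⁻ [] u = [] , u
unique-++⁻ (x ∷ p) (x∉ ∷ u) = let up , uq = unique-++⁻ p u in All.++⁻ˡ p x∉ ∷ up , uq

-- Walks: splitting, closed vertex sets and loop erasure.

module DigraphLemmas (dec : ExcludedMiddle 0ℓ) (D : Digraph) where
  open Digraph D

  chain-++⁺ : ∀ {v} p {q} → Chain v p → Chain (endV v p) q → Chain v (p ++ q)
  chain-++⁺ [] _ cq = cq
  chain-++⁺ (a ∷ p) (eq , cp) cq = eq , chain-++⁺ p cp cq

  chain-++⁻ : ∀ {v} p {q} → Chain v (p ++ q) → Chain v p × Chain (endV v p) q
  chain-++⁻ [] c = tt , c
  chain-++⁻ (a ∷ p) (eq , c) = let cp , cq = chain-++⁻ p c in (eq , cp) , cq

  endV-++ : ∀ v p q → endV v (p ++ q) ≡ endV (endV v p) q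
  endV-++ v [] q = refl
  endV-++ v (a ∷ p) q = endV-++ (head a) p q

  first∈verts : ∀ v es → v ∈ verts v es
  first∈verts v [] = here refl
  first∈verts v (_ ∷ _) = here refl

  tail∈verts : ∀ {v es a} → Chain v es → a ∈ es → tail a ∈ verts v es
  tail∈verts (eq , _) (here refl) = here eq
  tail∈verts (_ , c) (there a∈) = there (tail∈verts c a∈)

  head∈verts : ∀ {v es a} → a ∈ es → head a ∈ verts v es
  head∈verts {es = a ∷ es} (here refl) = there (first∈verts (head a) es)
  head∈verts (there a∈) = there (head∈verts a∈)

  simple⇒distinct : ∀ {v es} → Chain v es → Unique (verts v es) → Unique es
  simple⇒distinct {es = []} _ _ = []
  simple⇒distinct {es = a ∷ es} (refl , c) (v∉ ∷ u) =
    All.tabulate (λ { b∈ refl → All.lookup v∉ (tail∈verts c b∈) refl }) ∷ simple⇒distinct c u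

  forward-closed : ∀ {X : Pred V 0ℓ} {v es} → Chain v es → X v →
                   (∀ {a} → a ∈ es → X (tail a) → X (head a)) → All X (verts v es)
  forward-closed {es = []} _ Xv _ = Xv ∷ []
  forward-closed {es = a ∷ es} (refl , c) Xv step =
    Xv ∷ forward-closed c (step (here refl) Xv) (step ∘ there)

  backward-closed : ∀ {X : Pred V 0ℓ} {v es} → Chain v es → X (endV v es) →
                    (∀ {a} → a ∈ es → X (head a) → X (tail a)) → All X (verts v es)
  backward-closed {es = []} _ Xv _ = Xv ∷ []
  backward-closed {es = a ∷ es} (refl , c) Xend step =
    let rest = backward-closed c Xend (step ∘ there)
    in step (here refl) (All.lookup rest (first∈verts (head a) es)) ∷ rest

  first-entry : ∀ (X : Pred V 0ℓ) {v} es → Chain v es → ¬ X v → X (endV v es) →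
                ∃ λ p → ∃ λ e → ∃ λ q → es ≡ p ++ e ∷ q × inD X e ×
                  All (λ a → ¬ X (tail a) × ¬ X (head a)) p
  first-entry X [] _ ¬Xv Xv = contradiction Xv ¬Xv
  first-entry X (a ∷ es) (refl , c) ¬Xv Xend with dec {X (head a)}
  ... | yes Xh = [] , a , es , refl , (¬Xv , Xh) , []
  ... | no ¬Xh = let p , e , q , eq , e-in , outside = first-entry X es c ¬Xh Xend
                 in a ∷ p , e , q , cong (a ∷_) eq , e-in , (¬Xv , ¬Xh) ∷ outside

  -- The pair `u`, `es` is the ambient walk. The start `v` is kept separate, so that the record also
  -- covers a final segment of that walk.
  record PathWithin (v u : V) (es : List A) : Set where
    field
      path : Path
      start≡ : start path ≡ v
      end≡ : end path ≡ endV u es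
      edges⊆ : ∀ {a} → a ∈ edges path → a ∈ es
      vertices⊆ : ∀ {x} → x ∈ vertices path → x ∈ verts u es

  widen : ∀ {v u a es} → PathWithin v (head a) es → PathWithin v u (a ∷ es)
  widen W = record
    { path = path ; start≡ = start≡ ; end≡ = end≡
    ; edges⊆ = there ∘ edges⊆ ; vertices⊆ = there ∘ vertices⊆ }
    where open PathWithin W

  path-from : ∀ {v u} es → Chain u es → Unique (verts u es) → v ∈ verts u es → PathWithin v u es
  path-from [] c s (here refl) = record
    { path = record { start = _ ; edges = [] ; chain = c ; simple = s }
    ; start≡ = refl ; end≡ = refl ; edges⊆ = id ; vertices⊆ = id }
  path-from (a ∷ es) c s (here refl) = record
    { path = record { start = _ ; edges = a ∷ es ; chain = c ; simple = s }
    ; start≡ = refl ; end≡ = refl ; edges⊆ = id ; vertices⊆ = id }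
  path-from (a ∷ es) (_ , c) (_ ∷ s) (there v∈) = widen (path-from es c s v∈)

  -- Loop erasure from the far end: if `u` reappears on the simple path already built from `head a`,
  -- the final segment from that occurrence is taken.
  shortcut : ∀ u es → Chain u es → PathWithin u u es
  shortcut u [] c = path-from [] c ([] ∷ []) (here refl)
  shortcut u (a ∷ es) (refl , c) = prepend (shortcut (head a) es c)
    where
    prepend : PathWithin (head a) (head a) es → PathWithin u u (a ∷ es)
    prepend record { path = P ; start≡ = refl ; end≡ = end≡ ; edges⊆ = edges⊆ ; vertices⊆ = vertices⊆ }
      with dec {u ∈ vertices P}
    ... | yes u∈ = record
      { path = path Q ; start≡ = start≡ Q ; end≡ = trans (end≡' Q) end≡
      ; edges⊆ = there ∘ edges⊆ ∘ edges⊆' Q ; vertices⊆ = there ∘ vertices⊆ ∘ vertices⊆' Q }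
      where
      open PathWithin renaming (end≡ to end≡'; edges⊆ to edges⊆'; vertices⊆ to vertices⊆')
      Q : PathWithin u (start P) (edges P)
      Q = path-from (edges P) (chain P) (simple P) u∈
    ... | no u∉ = record
      { path = record { start = u ; edges = a ∷ edges P ; chain = refl , chain P
                      ; simple = All.tabulate (λ { x∈ refl → u∉ x∈ }) ∷ simple P }
      ; start≡ = refl ; end≡ = end≡
      ; edges⊆ = λ { (here eq) → here eq ; (there a∈) → there (edges⊆ a∈) }
      ; vertices⊆ = λ { (here eq) → here eq ; (there x∈) → there (vertices⊆ x∈) } }

-- Trails ending at `t`.

module Trails (dec : ExcludedMiddle 0ℓ) (D : Digraph) (t : Digraph.V D) where
  open Digraph D
  open DigraphLemmas dec D

  record Trail : Set where
    field
      src : V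
      arcs : List A
      linked : Chain src arcs
      reaches : endV src arcs ≡ t
      distinct : Unique arcs

  open Trail public

  stop : Trail
  stop = record { src = t ; arcs = [] ; linked = tt ; reaches = refl ; distinct = [] }

  fromPath : (P : Path) → end P ≡ t → Trail
  fromPath P end≡t = record
    { src = start P ; arcs = edges P ; linked = chain P ; reaches = end≡t
    ; distinct = simple⇒distinct (chain P) (simple P) }

  toPath : Trail → Path
  toPath w = PathWithin.path (shortcut (src w) (arcs w) (linked w))

  start-toPath : ∀ w → start (toPath w) ≡ src w
  start-toPath w = PathWithin.start≡ (shortcut (src w) (arcs w) (linked w))

  end-toPath : ∀ w → end (toPath w) ≡ t
  end-toPath w = trans (PathWithin.end≡ (shortcut (src w) (arcs w) (linked w))) (reaches w)

  edges-toPath : ∀ w {a} → a ∈ edges (toPath w) → a ∈ arcs w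
  edges-toPath w = PathWithin.edges⊆ (shortcut (src w) (arcs w) (linked w))

  toPath-induced : ∀ {X} w → All X (verts (src w) (arcs w)) → InInduced X (toPath w)
  toPath-induced w inX = All.tabulate λ x∈ →
    All.lookup inX (PathWithin.vertices⊆ (shortcut (src w) (arcs w) (linked w)) x∈)

  prepend : ∀ e w → head e ≡ src w → ¬ e ∈ arcs w → Trail
  prepend e w h e∉ = record
    { src = tail e ; arcs = e ∷ arcs w
    ; linked = refl , subst (λ v → Chain v (arcs w)) (sym h) (linked w)
    ; reaches = trans (cong (λ v → endV v (arcs w)) h) (reaches w)
    ; distinct = All.tabulate (λ { a∈ refl → e∉ a∈ }) ∷ distinct w }

  module _ (w : Trail) (p : List A) {e : A} {q : List A} (eq : arcs w ≡ p ++ e ∷ q) where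
    private
      chains : Chain (src w) p × Chain (endV (src w) p) (e ∷ q)
      chains = chain-++⁻ p (subst (Chain (src w)) eq (linked w))

      uniques : Unique p × Unique (e ∷ q)
      uniques = unique-++⁻ p (subst Unique eq (distinct w))

    e∈arcs : e ∈ arcs w
    e∈arcs = subst (e ∈_) (sym eq) (∈-++⁺ʳ p (here refl))

    prefix⊆ : ∀ {a} → a ∈ p → a ∈ arcs w
    prefix⊆ a∈ = subst (_ ∈_) (sym eq) (∈-++⁺ˡ a∈)

    suffix⊆ : ∀ {a} → a ∈ q → a ∈ arcs w
    suffix⊆ a∈ = subst (_ ∈_) (sym eq) (∈-++⁺ʳ p (there a∈))

    arcs-split : ∀ {a} → a ∈ arcs w → a ∈ p ⊎ a ≡ e ⊎ a ∈ q
    arcs-split a∈ with ∈-++⁻ p (subst (_ ∈_) eq a∈)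
    ... | inj₁ a∈p = inj₁ a∈p
    ... | inj₂ (here a≡e) = inj₂ (inj₁ a≡e)
    ... | inj₂ (there a∈q) = inj₂ (inj₂ a∈q)

    prefix#suffix : ∀ {a} → a ∈ p → a ∈ q → ⊥
    prefix#suffix a∈p a∈q = disj p (subst Unique eq (distinct w)) a∈p a∈q
      where
      disj : ∀ p {q a} → Unique (p ++ e ∷ q) → a ∈ p → a ∈ q → ⊥
      disj (b ∷ p) (b∉ ∷ _) (here refl) a∈q = All.lookup b∉ (∈-++⁺ʳ p (there a∈q)) refl
      disj (b ∷ p) (_ ∷ u) (there a∈p) a∈q = disj p u a∈p a∈q

    after : Trail
    after = record
      { src = head e ; arcs = q ; linked = proj₂ (proj₂ chains)
      ; reaches = trans (sym (endV-++ (src w) p (e ∷ q)))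
                        (trans (cong (endV (src w)) (sym eq)) (reaches w))
      ; distinct = case proj₂ uniques of λ { (_ ∷ u) → u } }

    divert : (x : Trail) → tail e ≡ src x → Disjoint p (arcs x) → Trail
    divert x h p#x = record
      { src = src w ; arcs = p ++ arcs x
      ; linked = chain-++⁺ p (proj₁ chains) (subst (λ v → Chain v (arcs x)) (sym meet) (linked x))
      ; reaches = trans (endV-++ (src w) p (arcs x))
                        (trans (cong (λ v → endV v (arcs x)) meet) (reaches x))
      ; distinct = ++⁺ (proj₁ uniques) (distinct x) p#x }
      where
      meet : endV (src w) p ≡ src x
      meet = trans (sym (proj₁ (proj₂ chains))) h

-- Trail linkages with an extra trail, and the moves between them.

module Augmentation (em : ExcludedMiddle (suc 0ℓ)) (R : MatroidRootedDigraph)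
                    (t : MatroidRootedDigraph.V R) where
  open MatroidRootedDigraph R
  open MatroidLemmas em M
  open DigraphLemmas dec D
  open Trails dec D t

  IsTrailLinkage : Pred S 0ℓ → (S → Trail) → Set
  IsTrailLinkage I F =
    (∀ {i} → I i → π i (src (F i))) ×
    (∀ {i j a} → I i → I j → a ∈ arcs (F i) → a ∈ arcs (F j) → i ≡ j)

  trailLinkage⇒linkable : ∀ {I} F → IsTrailLinkage I F → Linkable I ｛ t ｝
  trailLinkage⇒linkable F (rooted , disjoint) =
    (λ i → toPath (F i)) ,
    (λ i Ii → subst (π i) (sym (start-toPath (F i))) (rooted Ii) , sym (end-toPath (F i))) ,
    (λ i j Ii Ij i≢j a a∈i a∈j →
      i≢j (disjoint Ii Ij (edges-toPath (F i) a∈i) (edges-toPath (F j) a∈j)))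

  replace : (S → Trail) → S → Trail → S → Trail
  replace F i w k with dec {i ≡ k}
  ... | yes _ = w
  ... | no _ = F k

  -- Abstracting over `replace F i w k` together with this disjunction lets a proof split on `i ≡ k`
  -- and learn the value at once.
  replaced : ∀ F i w k → (i ≡ k × replace F i w k ≡ w) ⊎ (i ≢ k × replace F i w k ≡ F k)
  replaced F i w k with dec {i ≡ k}
  ... | yes eq = inj₁ (eq , refl)
  ... | no neq = inj₂ (neq , refl)

  -- The extra trail belongs to no element of `S`: its source is the moving end of the search for an
  -- augmentation.
  record State : Set₁ where
    field
      Idx : Pred S 0ℓ
      indep : Indep Idx
      fam : S → Trail
      extra : Trail
      linkage : IsTrailLinkage Idx fam
      extra# : ∀ {i a} → Idx i → a ∈ arcs (fam i) → a ∈ arcs extra → ⊥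

    Used : Pred A 0ℓ
    Used a = a ∈ arcs extra ⊎ (∃ λ i → Idx i × a ∈ arcs (fam i))

  open State

  grow : ∀ σ e → head e ≡ src (extra σ) → ¬ Used σ e → State
  grow σ e h unused = record
    { Idx = Idx σ ; indep = indep σ ; fam = fam σ ; linkage = linkage σ
    ; extra = prepend e (extra σ) h (unused ∘ inj₁)
    ; extra# = λ { Ii a∈ (here refl) → unused (inj₂ (_ , Ii , a∈))
                 ; Ii a∈ (there a∈x) → extra# σ Ii a∈ a∈x } }

  shrink : ∀ σ {e q} → arcs (extra σ) ≡ e ∷ q → State
  shrink σ eq = record
    { Idx = Idx σ ; indep = indep σ ; fam = fam σ ; linkage = linkage σ
    ; extra = after (extra σ) [] eq
    ; extra# = λ Ii a∈ a∈q → extra# σ Ii a∈ (suffix⊆ (extra σ) [] eq a∈q) }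

  module _ (σ : State) {i : S} (Ii : Idx σ i) (p : List A) {e : A} {q : List A}
           (eq : arcs (fam σ i) ≡ p ++ e ∷ q) (h : tail e ≡ src (extra σ)) where
    private
      diverted : Trail
      diverted = divert (fam σ i) p eq (extra σ) h
        (λ (a∈p , a∈x) → extra# σ Ii (prefix⊆ (fam σ i) p eq a∈p) a∈x)

    -- At the vertex `tail e` the trail of `i` switches to the extra trail. What it used to traverse
    -- after `e` becomes the new extra trail, and `e` alone falls out of use.
    reroute : State
    reroute = record
      { Idx = Idx σ ; indep = indep σ
      ; fam = replace (fam σ) i diverted
      ; extra = after (fam σ i) p eq
      ; linkage = rooted , disjoint
      ; extra# = separate }
      where
      rooted : ∀ {k} → Idx σ k → π k (src (replace (fam σ) i diverted k))
      rooted {k} Ik with replace (fam σ) i diverted k | replaced (fam σ) i diverted k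
      ... | _ | inj₁ (refl , refl) = proj₁ (linkage σ) Ik
      ... | _ | inj₂ (_ , refl) = proj₁ (linkage σ) Ik

      meets : ∀ {k a} → Idx σ k → a ∈ arcs diverted → a ∈ arcs (fam σ k) → i ≡ k
      meets Ik a∈d a∈k with ∈-++⁻ p a∈d
      ... | inj₁ a∈p = proj₂ (linkage σ) Ii Ik (prefix⊆ (fam σ i) p eq a∈p) a∈k
      ... | inj₂ a∈x = ⊥-elim (extra# σ Ik a∈k a∈x)

      disjoint : ∀ {j k a} → Idx σ j → Idx σ k → a ∈ arcs (replace (fam σ) i diverted j) →
                 a ∈ arcs (replace (fam σ) i diverted k) → j ≡ k
      disjoint {j} {k} Ij Ik a∈j a∈k
        with replace (fam σ) i diverted j | replaced (fam σ) i diverted j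
           | replace (fam σ) i diverted k | replaced (fam σ) i diverted k
      ... | _ | inj₁ (i≡j , refl) | _ | inj₁ (i≡k , refl) = trans (sym i≡j) i≡k
      ... | _ | inj₁ (i≡j , refl) | _ | inj₂ (_ , refl) = trans (sym i≡j) (meets Ik a∈j a∈k)
      ... | _ | inj₂ (_ , refl) | _ | inj₁ (i≡k , refl) = trans (sym (meets Ij a∈k a∈j)) i≡k
      ... | _ | inj₂ (_ , refl) | _ | inj₂ (_ , refl) = proj₂ (linkage σ) Ij Ik a∈j a∈k

      separate : ∀ {k a} → Idx σ k → a ∈ arcs (replace (fam σ) i diverted k) → a ∈ q → ⊥
      separate {k} Ik a∈k a∈q with replace (fam σ) i diverted k | replaced (fam σ) i diverted k
      ... | _ | inj₂ (i≢k , refl) =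
        i≢k (proj₂ (linkage σ) Ii Ik (suffix⊆ (fam σ i) p eq a∈q) a∈k)
      ... | _ | inj₁ (_ , refl) with ∈-++⁻ p a∈k
      ...   | inj₁ a∈p = prefix#suffix (fam σ i) p eq a∈p a∈q
      ...   | inj₂ a∈x = extra# σ Ii (suffix⊆ (fam σ i) p eq a∈q) a∈x

    src-reroute : ∀ k → src (fam reroute k) ≡ src (fam σ k)
    src-reroute k with replace (fam σ) i diverted k | replaced (fam σ) i diverted k
    ... | _ | inj₁ (refl , refl) = refl
    ... | _ | inj₂ (_ , refl) = refl

    used-reroute : ∀ {a} → a ≢ e → Used σ a → Used reroute a
    used-reroute a≢e (inj₁ a∈x) = inj₂ (i , Ii , moved)
      where
      moved : _ ∈ arcs (replace (fam σ) i diverted i)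
      moved with replace (fam σ) i diverted i | replaced (fam σ) i diverted i
      ... | _ | inj₁ (_ , refl) = ∈-++⁺ʳ p a∈x
      ... | _ | inj₂ (i≢i , _) = contradiction refl i≢i
    used-reroute a≢e (inj₂ (k , Ik , a∈k))
      with replace (fam σ) i diverted k in at-k | replaced (fam σ) i diverted k
    ... | _ | inj₂ (_ , refl) = inj₂ (k , Ik , subst (λ w → _ ∈ arcs w) (sym at-k) a∈k)
    ... | _ | inj₁ (refl , refl) with arcs-split (fam σ i) p eq a∈k
    ...   | inj₁ a∈p = inj₂ (k , Ik , subst (λ w → _ ∈ arcs w) (sym at-k) (∈-++⁺ˡ a∈p))
    ...   | inj₂ (inj₁ a≡e) = contradiction a≡e a≢e
    ...   | inj₂ (inj₂ a∈q) = inj₁ a∈q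

    used-reroute⁻ : ∀ {a} → Used reroute a → Used σ a
    used-reroute⁻ (inj₁ a∈q) = inj₂ (i , Ii , suffix⊆ (fam σ i) p eq a∈q)
    used-reroute⁻ (inj₂ (k , Ik , a∈k))
      with replace (fam σ) i diverted k | replaced (fam σ) i diverted k
    ... | _ | inj₂ (_ , refl) = inj₂ (k , Ik , a∈k)
    ... | _ | inj₁ (refl , refl) with ∈-++⁻ p a∈k
    ...   | inj₁ a∈p = inj₂ (k , Ik , prefix⊆ (fam σ i) p eq a∈p)
    ...   | inj₂ a∈x = inj₁ a∈x

  addTrail : ∀ {I F s w} → IsTrailLinkage I F → π s (src w) →
             (∀ {i a} → I i → a ∈ arcs (F i) → a ∈ arcs w → ⊥) →
             IsTrailLinkage (I ∪ ｛ s ｝) (replace F s w)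
  addTrail {I} {F} {s} {w} (rooted , disjoint) πs w# = rooted' , disjoint'
    where
    kept : ∀ {k} → s ≢ k → (I ∪ ｛ s ｝) k → I k
    kept s≢k (inj₁ Ik) = Ik
    kept s≢k (inj₂ s≡k) = contradiction s≡k s≢k

    rooted' : ∀ {k} → (I ∪ ｛ s ｝) k → π k (src (replace F s w k))
    rooted' {k} Ik with replace F s w k | replaced F s w k
    ... | _ | inj₁ (refl , refl) = πs
    ... | _ | inj₂ (s≢k , refl) = rooted (kept s≢k Ik)

    disjoint' : ∀ {j k a} → (I ∪ ｛ s ｝) j → (I ∪ ｛ s ｝) k →
                a ∈ arcs (replace F s w j) → a ∈ arcs (replace F s w k) → j ≡ k
    disjoint' {j} {k} Ij Ik a∈j a∈k
      with replace F s w j | replaced F s w j | replace F s w k | replaced F s w k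
    ... | _ | inj₁ (s≡j , _) | _ | inj₁ (s≡k , _) = trans (sym s≡j) s≡k
    ... | _ | inj₁ (_ , refl) | _ | inj₂ (s≢k , refl) = ⊥-elim (w# (kept s≢k Ik) a∈k a∈j)
    ... | _ | inj₂ (s≢j , refl) | _ | inj₁ (_ , refl) = ⊥-elim (w# (kept s≢j Ij) a∈j a∈k)
    ... | _ | inj₂ (s≢j , refl) | _ | inj₂ (s≢k , refl) = disjoint (kept s≢j Ij) (kept s≢k Ik) a∈j a∈k

  module _ (σ : State) {s i : S} (πs : π s (src (extra σ))) (Ii : Idx σ i)
           (ind : Indep ((Idx σ ∖ ｛ i ｝) ∪ ｛ s ｝)) where

    -- The element `s` takes over the extra trail, and the trail given up by `i` becomes the extra
    -- one. For `s ≡ i` this interchanges two trails and leaves the index set as it is.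
    swap : State
    swap = record
      { Idx = (Idx σ ∖ ｛ i ｝) ∪ ｛ s ｝ ; indep = ind
      ; fam = replace (fam σ) s (extra σ)
      ; extra = fam σ i
      ; linkage = addTrail ((λ (Ik , _) → proj₁ (linkage σ) Ik) ,
                            (λ (Ij , _) (Ik , _) → proj₂ (linkage σ) Ij Ik))
                           πs (λ (Ik , _) → extra# σ Ik)
      ; extra# = separate }
      where
      separate : ∀ {k a} → ((Idx σ ∖ ｛ i ｝) ∪ ｛ s ｝) k →
                 a ∈ arcs (replace (fam σ) s (extra σ) k) → a ∈ arcs (fam σ i) → ⊥
      separate {k} Ik a∈k a∈i with replace (fam σ) s (extra σ) k | replaced (fam σ) s (extra σ) k
      ... | _ | inj₁ (_ , refl) = extra# σ Ii a∈i a∈k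
      separate (inj₁ (Ik , i≢k)) a∈k a∈i | _ | inj₂ (_ , refl) = i≢k (proj₂ (linkage σ) Ii Ik a∈i a∈k)
      separate (inj₂ s≡k) a∈k a∈i | _ | inj₂ (s≢k , _) = s≢k s≡k

    -- The first hypothesis rules out that `s` is another member of the linkage, whose trail would
    -- be overwritten and its edges lost.
    used-swap : ∀ {a} → (s ≢ i → ¬ Idx σ s) → Used σ a → Used swap a
    used-swap fresh (inj₁ a∈x) = inj₂ (s , inj₂ refl , moved)
      where
      moved : _ ∈ arcs (replace (fam σ) s (extra σ) s)
      moved with replace (fam σ) s (extra σ) s | replaced (fam σ) s (extra σ) s
      ... | _ | inj₁ (_ , refl) = a∈x
      ... | _ | inj₂ (s≢s , _) = contradiction refl s≢s
    used-swap fresh (inj₂ (k , Ik , a∈k)) with dec {i ≡ k}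
    ... | yes refl = inj₁ a∈k
    ... | no i≢k with replace (fam σ) s (extra σ) k in at-k | replaced (fam σ) s (extra σ) k
    ...   | _ | inj₁ (refl , refl) = contradiction Ik (fresh (i≢k ∘ sym))
    ...   | _ | inj₂ (_ , refl) = inj₂ (k , inj₁ (Ik , i≢k) , subst (λ w → _ ∈ arcs w) (sym at-k) a∈k)

    used-swap⁻ : ∀ {a} → Used swap a → Used σ a
    used-swap⁻ (inj₁ a∈i) = inj₂ (i , Ii , a∈i)
    used-swap⁻ (inj₂ (k , Ik , a∈k)) with replace (fam σ) s (extra σ) k | replaced (fam σ) s (extra σ) k
    ... | _ | inj₁ (_ , refl) = inj₁ a∈k
    used-swap⁻ (inj₂ (k , inj₁ (Ik , _) , a∈k)) | _ | inj₂ (_ , refl) = inj₂ (k , Ik , a∈k)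
    used-swap⁻ (inj₂ (k , inj₂ s≡k , _)) | _ | inj₂ (s≢k , _) = contradiction s≡k s≢k

  -- The last argument of `swapped` keeps the span from shrinking: either the index set is
  -- unchanged, or `s` was dependent on it and `exchange-spans` recovers `i`.
  data Reach (σ₀ : State) : State → Set₁ where
    init : Reach σ₀ σ₀
    grown : ∀ {σ e} → Reach σ₀ σ → (h : head e ≡ src (extra σ)) (unused : ¬ Used σ e) →
            Reach σ₀ (grow σ e h unused)
    shrunk : ∀ {σ e q} → Reach σ₀ σ → (eq : arcs (extra σ) ≡ e ∷ q) → Reach σ₀ (shrink σ eq)
    rerouted : ∀ {σ i p e q} → Reach σ₀ σ → (Ii : Idx σ i) (eq : arcs (fam σ i) ≡ p ++ e ∷ q)
               (h : tail e ≡ src (extra σ)) → Reach σ₀ (reroute σ Ii p eq h)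
    swapped : ∀ {σ s i} → Reach σ₀ σ → (πs : π s (src (extra σ))) (Ii : Idx σ i)
              (ind : Indep ((Idx σ ∖ ｛ i ｝) ∪ ｛ s ｝)) → s ≡ i ⊎ ¬ Indep (Idx σ ∪ ｛ s ｝) →
              Reach σ₀ (swap σ πs Ii ind)

  indep-readd : ∀ {I i} → Indep I → I i → Indep ((I ∖ ｛ i ｝) ∪ ｛ i ｝)
  indep-readd {I} indI Ii = indep-⊆ I _ [ proj₁ , (λ { refl → Ii }) ] indI

  reach-span : ∀ {σ₀ σ} → Reach σ₀ σ → span (Idx σ₀) ⊆ span (Idx σ)
  reach-span init x∈ = x∈
  reach-span (grown r _ _) x∈ = reach-span r x∈
  reach-span (shrunk r _) x∈ = reach-span r x∈
  reach-span (rerouted r _ _ _) x∈ = reach-span r x∈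
  reach-span (swapped {σ} {s} {i} r πs Ii ind exch) x∈ =
    span-closed ind (sub exch) (reach-span r x∈)
    where
    sub : s ≡ i ⊎ ¬ Indep (Idx σ ∪ ｛ s ｝) → Idx σ ⊆ span ((Idx σ ∖ ｛ i ｝) ∪ ｛ s ｝)
    sub (inj₂ dep) = exchange-spans ind dep
    sub (inj₁ refl) {x} Ix with dec {i ≡ x}
    ... | yes i≡x = inj₁ (inj₂ i≡x)
    ... | no i≢x = inj₁ (inj₁ (Ix , i≢x))

  -- A search without augmentation: the set `Z` of sources is good.

  -- Reaching a state only alters the linkage inside Z, hence σ₀ itself witnesses that Z is good.
  module Stuck (σ₀ : State)
    (stuck : ∀ {σ} → Reach σ₀ σ → ∀ {s} → π s (src (extra σ)) → ¬ Idx σ s → ¬ Indep (Idx σ ∪ ｛ s ｝))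
    where

    abstract
      -- Truncated to a small proposition, since states live in Set₁.
      Z : Pred V 0ℓ
      Z v = True (em {∃ λ σ → Reach σ₀ σ × src (extra σ) ≡ v})

      src∈Z : ∀ {σ} → Reach σ₀ σ → Z (src (extra σ))
      src∈Z r = fromWitness (_ , r , refl)

      Z⇒state : ∀ {v} → Z v → ∃ λ σ → Reach σ₀ σ × src (extra σ) ≡ v
      Z⇒state = toWitness

    -- Repeated shrinking turns each vertex of the extra trail into a source.
    extra⊆Z : ∀ {σ} → Reach σ₀ σ → All Z (verts (src (extra σ)) (arcs (extra σ)))
    extra⊆Z {σ} r = go r (arcs (extra σ)) refl
      where
      go : ∀ {σ} → Reach σ₀ σ → ∀ es → arcs (extra σ) ≡ es → All Z (verts (src (extra σ)) es)
      go r [] _ = src∈Z r ∷ []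
      go r (e ∷ es) eq = src∈Z r ∷ go (shrunk r eq) es refl

    -- The swap with `s ≡ i` makes the start of the old trail of `i` the source.
    member-src∈Z : ∀ {σ i} → Reach σ₀ σ → π i (src (extra σ)) → Idx σ i → Z (src (fam σ i))
    member-src∈Z {σ} r πi Ii = src∈Z (swapped r πi Ii (indep-readd (indep σ) Ii) (inj₁ refl))

    -- For `σ₀` this becomes the base of `𝒮 Z`. `Z` stays fixed while the state varies.
    K : State → Pred S 0ℓ
    K σ i = Idx σ i × Z (src (fam σ i))

    -- For `s` outside the index set, each other element of its fundamental circuit can be swapped
    -- for `s`, so its trail starts in `Z`. The circuit thus lies in `K σ` together with `s`.
    root-spanned : ∀ {σ s} → Reach σ₀ σ → π s (src (extra σ)) → span (K σ) s
    root-spanned {σ} {s} r πs with dec {Idx σ s}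
    ... | yes Is = inj₁ (Is , member-src∈Z r πs Is)
    ... | no ¬Is = inj₂ (_ , (λ (Ii , ind) → Ii , src∈Z (swapped r πs Ii ind (inj₂ dep)))
                           , indep-⊆ (Idx σ) _ proj₁ (indep σ) , fundamental-circuit (indep σ) dep)
      where
      dep : ¬ Indep (Idx σ ∪ ｛ s ｝)
      dep = stuck r πs ¬Is

    K-indep : ∀ σ → Indep (K σ)
    K-indep σ = indep-⊆ (Idx σ) (K σ) proj₁ (indep σ)

    -- Among the moves only a swap can bring a new element into `K`, and `root-spanned` shows that
    -- this element is already spanned.
    K-span : ∀ {σ} → Reach σ₀ σ → span (K σ) ⊆ span (K σ₀)
    K-span init x∈ = x∈
    K-span (grown r _ _) x∈ = K-span r x∈
    K-span (shrunk r _) x∈ = K-span r x∈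
    K-span (rerouted {σ} {p = p} r Ii eq h) x∈ =
      K-span r (span-mono (λ (Ik , Zk) → Ik , subst Z (src-reroute σ Ii p eq h _) Zk) x∈)
    K-span (swapped {σ} {s} {i} r πs Ii ind _) x∈ = K-span r (span-closed (K-indep σ) sub x∈)
      where
      sub : K (swap σ πs Ii ind) ⊆ span (K σ)
      sub {k} (Ik , Zk) with replace (fam σ) s (extra σ) k | replaced (fam σ) s (extra σ) k
      ... | _ | inj₁ (refl , _) = root-spanned r πs
      sub (inj₁ (Ik , _) , Zk) | _ | inj₂ (_ , refl) = inj₁ (Ik , Zk)
      sub (inj₂ s≡k , _) | _ | inj₂ (s≢k , _) = contradiction s≡k s≢k

    Outer : State → Pred S 0ℓ
    Outer σ i = Idx σ i × ¬ Z (src (fam σ i))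

    outer-kept : ∀ {σ} → Reach σ₀ σ → Outer σ₀ ⊆ Outer σ
    outer-kept init o = o
    outer-kept (grown r _ _) o = outer-kept r o
    outer-kept (shrunk r _) o = outer-kept r o
    outer-kept (rerouted {σ} {p = p} r Ii eq h) o =
      let Ik , ¬Zk = outer-kept r o in Ik , ¬Zk ∘ subst Z (src-reroute σ Ii p eq h _)
    outer-kept (swapped {σ} {s} {i} r πs Ii ind exch) {k} o
      with outer-kept r o
    ... | Ik , ¬Zk with replace (fam σ) s (extra σ) k | replaced (fam σ) s (extra σ) k
    ...   | _ | inj₁ (refl , _) = contradiction (member-src∈Z r πs Ik) ¬Zk
    ...   | _ | inj₂ (_ , refl) =
      inj₁ (Ik , λ { refl → ¬Zk (src∈Z (swapped r πs Ii ind exch)) }) ,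
      ¬Zk

    Inside : Pred A 0ℓ
    Inside a = Z (tail a) × Z (head a)

    -- A move changes the use of at most one edge, and that edge joins the old source to the new
    -- one, both in `Z`. A swap changes none.
    used-kept : ∀ {σ} → Reach σ₀ σ → ∀ {a} → ¬ Inside a →
                (Used σ₀ a → Used σ a) × (Used σ a → Used σ₀ a)
    used-kept init ¬in = id , id
    used-kept (grown {σ} {e} r h unused) {a} ¬in =
      let to , from = used-kept r ¬in in
      [ inj₁ ∘ there , inj₂ ] ∘ to , from ∘ back
      where
      back : Used (grow σ e h unused) a → Used σ a
      back (inj₁ (here refl)) = ⊥-elim (¬in (src∈Z (grown r h unused) , subst Z (sym h) (src∈Z r)))
      back (inj₁ (there a∈)) = inj₁ a∈
      back (inj₂ u) = inj₂ u
    used-kept (shrunk {σ} {e} {q} r eq) {a} ¬in =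
      let to , from = used-kept r ¬in in
      forth ∘ to , from ∘ [ inj₁ ∘ suffix⊆ (extra σ) [] eq , inj₂ ]
      where
      forth : Used σ a → Used (shrink σ eq) a
      forth (inj₂ u) = inj₂ u
      forth (inj₁ a∈) with arcs-split (extra σ) [] eq a∈
      ... | inj₂ (inj₁ refl) =
        ⊥-elim (¬in (All.lookup (extra⊆Z r) (tail∈verts (linked (extra σ)) a∈) , src∈Z (shrunk r eq)))
      ... | inj₂ (inj₂ a∈q) = inj₁ a∈q
    used-kept (rerouted {σ} {p = p} r Ii eq h) ¬in =
      let to , from = used-kept r ¬in in
      used-reroute σ Ii p eq h
        (λ { refl → ¬in (subst Z (sym h) (src∈Z r) , src∈Z (rerouted {p = p} r Ii eq h)) }) ∘ to ,
      from ∘ used-reroute⁻ σ Ii p eq h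
    used-kept (swapped {σ} {s} {i} r πs Ii ind exch) ¬in =
      let to , from = used-kept r ¬in in
      used-swap σ πs Ii ind (fresh exch) ∘ to , from ∘ used-swap⁻ σ πs Ii ind
      where
      fresh : s ≡ i ⊎ ¬ Indep (Idx σ ∪ ｛ s ｝) → s ≢ i → ¬ Idx σ s
      fresh (inj₁ s≡i) s≢i _ = s≢i s≡i
      fresh (inj₂ dep) _ Is = dep (indep-⊆ (Idx σ) _ [ id , (λ { refl → Is }) ] (indep σ))

    entering-used : ∀ {e} → inD Z e → ∃ λ i → Idx σ₀ i × e ∈ arcs (fam σ₀ i)
    entering-used {e} (¬Zt , Zh) with Z⇒state Zh
    ... | σ , r , eq with dec {Used σ e}
    ...   | no unused = contradiction (src∈Z (grown r (sym eq) unused)) ¬Zt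
    ...   | yes used with proj₂ (used-kept r (¬Zt ∘ proj₁)) used
    ...     | inj₂ u = u
    ...     | inj₁ e∈ = contradiction
      (All.lookup (extra⊆Z init) (tail∈verts (linked (extra σ₀)) e∈)) ¬Zt

    -- An edge leaving `Z` would still be used in a state whose source is `tail e`. Then `head e`
    -- lies on the extra trail or becomes the source by rerouting, so it is in `Z`.
    no-leaving : ∀ {i e} → Idx σ₀ i → e ∈ arcs (fam σ₀ i) → Z (tail e) → Z (head e)
    no-leaving {i} {e} Ii e∈ Zt = decidable-stable dec λ ¬Zh →
      let σ , r , eq = Z⇒state Zt
      in ¬Zh (reached r (sym eq) (proj₁ (used-kept r (¬Zh ∘ proj₂)) (inj₂ (i , Ii , e∈))))
      where
      reached : ∀ {σ} → Reach σ₀ σ → tail e ≡ src (extra σ) → Used σ e → Z (head e)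
      reached r h (inj₁ e∈x) = All.lookup (extra⊆Z r) (head∈verts e∈x)
      reached r h (inj₂ (k , Ik , e∈k)) =
        let p , q , split = ∈-∃++ e∈k in src∈Z (rerouted {p = p} r Ik split h)

    inner-trail⊆Z : ∀ {i} → K σ₀ i → All Z (verts (src (fam σ₀ i)) (arcs (fam σ₀ i)))
    inner-trail⊆Z {i} (Ii , Zi) = forward-closed (linked (fam σ₀ i)) Zi (no-leaving Ii)

    inner-not-entering : ∀ {i e} → K σ₀ i → e ∈ arcs (fam σ₀ i) → ¬ inD Z e
    inner-not-entering {i} Ki e∈ (¬Zt , _) =
      ¬Zt (All.lookup (inner-trail⊆Z Ki) (tail∈verts (linked (fam σ₀ i)) e∈))

    after⊆Z : ∀ {i e} p {q} → Idx σ₀ i → arcs (fam σ₀ i) ≡ p ++ e ∷ q → inD Z e →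
              All Z (verts (head e) q)
    after⊆Z {i} p Ii eq (_ , Zh) =
      forward-closed (linked (after (fam σ₀ i) p eq)) Zh
        (no-leaving Ii ∘ suffix⊆ (fam σ₀ i) p eq)

    entering-later : ∀ {i e e'} p {q} → Idx σ₀ i → arcs (fam σ₀ i) ≡ p ++ e ∷ q → inD Z e →
                     e' ∈ q → ¬ inD Z e'
    entering-later {i} p Ii eq e-in e'∈q (¬Zt , _) = ¬Zt
      (All.lookup (after⊆Z p Ii eq e-in) (tail∈verts (linked (after (fam σ₀ i) p eq)) e'∈q))

    -- Once inside `Z` a trail never leaves it, so it has no second entry.
    entering-unique : ∀ {i e e'} → Idx σ₀ i → e ∈ arcs (fam σ₀ i) → e' ∈ arcs (fam σ₀ i) →
                      inD Z e → inD Z e' → e ≡ e'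
    entering-unique {i} {e} {e'} Ii e∈ e'∈ e-in e'-in with ∈-∃++ e∈
    ... | p , q , eq with arcs-split (fam σ₀ i) p eq e'∈
    ...   | inj₂ (inj₁ refl) = refl
    ...   | inj₂ (inj₂ e'∈q) = contradiction e'-in (entering-later p Ii eq e-in e'∈q)
    ...   | inj₁ e'∈p with ∈-∃++ e'∈p
    ...     | p₁ , p₂ , refl = contradiction e-in
      (entering-later p₁ Ii (trans eq (++-assoc p₁ (e' ∷ p₂) (e ∷ q))) e'-in (∈-++⁺ʳ p₂ (here refl)))

    roots-spanned : 𝒮 Z ⊆ span (K σ₀)
    roots-spanned (v , πv , Zv) with Z⇒state Zv
    ... | σ , r , refl = K-span r (root-spanned r πv)

    K-base : IsBaseOf (𝒮 Z) (K σ₀)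
    K-base = (λ (Ii , Zi) → _ , proj₁ (linkage σ₀) Ii , Zi) , K-indep σ₀ ,
      λ J indJ K⊆J J⊆ Jj → span-∩-indep indJ K⊆J Jj (roots-spanned (J⊆ Jj))

    -- Besides what `Good` asks of the path for `e`, this remembers the trail of `σ₀` from which the
    -- path is cut, because disjointness is inherited from the linkage.
    record Entry (e : A) (P : Path) : Set where
      field
        start≡ : start P ≡ head e
        end≡ : end P ≡ t
        induced : InInduced Z P
        owner : S
        owner∈ : Idx σ₀ owner
        e∈owner : e ∈ arcs (fam σ₀ owner)
        within : ∀ {a} → a ∈ edges P → a ∈ arcs (fam σ₀ owner)

    open Entry

    entry : ∀ e → inD Z e → ∃ (Entry e)
    entry e e-in =
      let i , Ii , e∈ = entering-used e-in
          p , q , eq = ∈-∃++ e∈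
          w = after (fam σ₀ i) p eq
      in toPath w , record
        { start≡ = start-toPath w ; end≡ = end-toPath w
        ; induced = toPath-induced w (after⊆Z p Ii eq e-in)
        ; owner = i ; owner∈ = Ii ; e∈owner = e∈
        ; within = λ a∈ → suffix⊆ (fam σ₀ i) p eq (edges-toPath w a∈) }

    entries-disjoint : ∀ {e e' P P'} → Entry e P → Entry e' P' → inD Z e → inD Z e' →
                       e ≢ e' → EdgeDisjoint P P'
    entries-disjoint E E' e-in e'-in e≢e' a a∈ a∈' =
      e≢e' (entering-unique (owner∈ E') (subst (λ i → _ ∈ arcs (fam σ₀ i)) same (e∈owner E))
                            (e∈owner E') e-in e'-in)
      where
      same : owner E ≡ owner E'
      same = proj₂ (linkage σ₀) (owner∈ E) (owner∈ E') (within E a∈) (within E' a∈')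

    inner-entry-disjoint : ∀ {b e P} → K σ₀ b → Entry e P → inD Z e →
                           EdgeDisjoint (toPath (fam σ₀ b)) P
    inner-entry-disjoint {b} Kb E e-in a a∈ a∈' =
      inner-not-entering Kb (subst (λ i → _ ∈ arcs (fam σ₀ i)) same (e∈owner E)) e-in
      where
      same : owner E ≡ b
      same = proj₂ (linkage σ₀) (owner∈ E) (proj₁ Kb) (within E a∈') (edges-toPath (fam σ₀ b) a∈)

    Z-good : Good t Z
    -- `toPath stop` is only the value at edges that do not enter `Z`.
    Z-good = let Pe , Pe-entry = choose dec {R = Entry} (toPath stop) entry in
      K σ₀ , K-base , (λ i → toPath (fam σ₀ i)) , Pe ,
      (λ b Kb → subst (π b) (sym (start-toPath (fam σ₀ b))) (proj₁ (linkage σ₀) (proj₁ Kb)) ,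
                end-toPath (fam σ₀ b) , toPath-induced (fam σ₀ b) (inner-trail⊆Z Kb)) ,
      (λ e e-in → let E = Pe-entry e e-in in start≡ E , end≡ E , induced E) ,
      (λ b b' Kb Kb' b≢b' a a∈ a∈' → b≢b' (proj₂ (linkage σ₀) (proj₁ Kb) (proj₁ Kb')
        (edges-toPath (fam σ₀ b) a∈) (edges-toPath (fam σ₀ b') a∈'))) ,
      (λ e e' e-in e'-in → entries-disjoint (Pe-entry e e-in) (Pe-entry e' e'-in) e-in e'-in) ,
      (λ b e Kb e-in → inner-entry-disjoint Kb (Pe-entry e e-in) e-in)

  augment-or-good : (σ₀ : State) →
    (∃ λ I' → Indep I' × Linkable I' ｛ t ｝ × span (Idx σ₀) ⊂ span I') ⊎
    (∃ λ Z → Good t Z × Z (src (extra σ₀)))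
  augment-or-good σ₀ = decide em
    where
    decide : Dec (∃ λ σ → Reach σ₀ σ × ∃ λ s →
                    π s (src (extra σ)) × ¬ Idx σ s × Indep (Idx σ ∪ ｛ s ｝)) →
      (∃ λ I' → Indep I' × Linkable I' ｛ t ｝ × span (Idx σ₀) ⊂ span I') ⊎
      (∃ λ Z → Good t Z × Z (src (extra σ₀)))
    decide (no none) = inj₂ (Z , Z-good , src∈Z init)
      where open Stuck σ₀ (λ r πs ¬Is ind → none (_ , r , _ , πs , ¬Is , ind))
    decide (yes (σ , r , s , πs , ¬Is , ind)) = inj₁
      (Idx σ ∪ ｛ s ｝ , ind , 
       trailLinkage⇒linkable (replace (fam σ) s (extra σ)) (addTrail (linkage σ) πs (extra# σ)) ,
       (λ x∈ → span-mono {Idx σ} inj₁ (reach-span r x∈)) ,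
       -- Strictness: `s` in `span (Idx σ₀)` would give `s` in `span (Idx σ)`, which the
       -- independence of `Idx σ ∪ ｛ s ｝` forbids.
       (λ sub → ¬Is (span-∩-indep {Idx σ} ind inj₁ (inj₂ refl)
         (reach-span r (sub {s} (inj₁ (inj₂ refl)))))))

  -- This places `t` in the largest good set, so that each path of the given linkage ends there.
  point-good : Good t ｛ t ｝
  point-good =
    let B , _ , base = indep-max ∅ (𝒮 ｛ t ｝) indep-∅ (λ ())
        B⊆ , _ = base
    in B , base , (λ _ → toPath stop) , (λ _ → toPath stop) ,
       (λ b Bb → case B⊆ Bb of λ { (_ , πb , refl) → πb , refl , refl ∷ [] }) ,
       (λ e (_ , t≡h) → t≡h , refl , refl ∷ []) ,
       (λ _ _ _ _ _ _ ()) , (λ _ _ _ _ _ _ ()) , (λ _ _ _ _ _ ())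

  -- Rerouting the given linkage inside the largest good set `T`.

  module AtLargestGood (T : Pred V 0ℓ) (largest : IsLargestGood t T)
                       (I : Pred S 0ℓ) (indI : Indep I)
                       (P : S → Path) (link : IsLinkage I ｛ t ｝ P) where

    Tt : T t
    Tt = proj₂ largest ｛ t ｝ point-good refl

    end∈T : ∀ {i} → I i → T (end (P i))
    end∈T Ii = subst T (proj₂ (proj₁ link _ Ii)) Tt

    P-disjoint : ∀ {i j a} → I i → I j → a ∈ edges (P i) → a ∈ edges (P j) → i ≡ j
    P-disjoint Ii Ij a∈i a∈j = decidable-stable dec λ i≢j → proj₂ link _ _ Ii Ij i≢j _ a∈i a∈j

    Iout : Pred S 0ℓ
    Iout = I ∖ 𝒮 T

    start∉T : ∀ {i} → Iout i → ¬ T (start (P i))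
    start∉T (Ii , i∉) Ts = i∉ (_ , proj₁ (proj₁ link _ Ii) , Ts)

    module Rerouting (B : Pred S 0ℓ) (B-base : IsBaseOf (𝒮 T) B) (Pb : S → Path) (Pe : A → Path)
      (Pb-ok : ∀ b → B b → π b (start (Pb b)) × end (Pb b) ≡ t × InInduced T (Pb b))
      (Pe-ok : ∀ e → inD T e → start (Pe e) ≡ head e × end (Pe e) ≡ t × InInduced T (Pe e))
      (Pb#Pb : ∀ b b' → B b → B b' → b ≢ b' → EdgeDisjoint (Pb b) (Pb b'))
      (Pe#Pe : ∀ e e' → inD T e → inD T e' → e ≢ e' → EdgeDisjoint (Pe e) (Pe e'))
      (Pb#Pe : ∀ b e → B b → inD T e → EdgeDisjoint (Pb b) (Pe e)) where

      Pb-tail : ∀ {b a} → B b → a ∈ edges (Pb b) → T (tail a)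
      Pb-tail {b} Bb a∈ = All.lookup (proj₂ (proj₂ (Pb-ok b Bb))) (tail∈verts (chain (Pb b)) a∈)

      Pe-tail : ∀ {e a} → inD T e → a ∈ edges (Pe e) → T (tail a)
      Pe-tail {e} e-in a∈ = All.lookup (proj₂ (proj₂ (Pe-ok e e-in))) (tail∈verts (chain (Pe e)) a∈)

      through : ∀ e → inD T e → Trail
      through e e-in@(¬Tt , _) = prepend e (fromPath (Pe e) (proj₁ (proj₂ (Pe-ok e e-in))))
        (sym (proj₁ (Pe-ok e e-in))) (λ e∈ → ¬Tt (Pe-tail e-in e∈))

      -- In `FromOutside`, `e` is the edge at which the trail leaves `P i` for `Pe e`. Sorting the
      -- other edges by whether their tail is outside `T` drives the disjointness proofs, and the
      -- clause on `head a` later shows that `P i` enters `T` once.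
      FromBase FromOutside : S → Trail → Set
      FromBase i w = B i × src w ≡ start (Pb i) × (∀ {a} → a ∈ arcs w → a ∈ edges (Pb i))
      FromOutside i w = Iout i × src w ≡ start (P i) ×
        ∃ λ e → inD T e × e ∈ edges (P i) × e ∈ arcs w ×
          (∀ {a} → a ∈ arcs w →
            (a ∈ edges (P i) × ¬ T (tail a) × (T (head a) → a ≡ e)) ⊎ a ∈ edges (Pe e))

      base-trail : ∀ {i} → B i → ∃ (FromBase i)
      base-trail {i} Bi = fromPath (Pb i) (proj₁ (proj₂ (Pb-ok i Bi))) , Bi , refl , id

      outside-trail : ∀ {i} → Iout i → ∃ (FromOutside i)
      outside-trail {i} o@(Ii , _)
        with p , e , q , eq , e-in , outside ←
               first-entry T (edges (P i)) (chain (P i)) (start∉T o) (end∈T Ii)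
        = divert w p eq (through e e-in) refl p#through ,
          o , refl , e , e-in , e∈arcs w p eq , ∈-++⁺ʳ p (here refl) , λ a∈ → classify (∈-++⁻ p a∈)
        where
        w : Trail
        w = fromPath (P i) (sym (proj₂ (proj₁ link i Ii)))

        p#through : Disjoint p (e ∷ edges (Pe e))
        p#through (a∈p , here refl) = proj₂ (All.lookup outside a∈p) (proj₂ e-in)
        p#through (a∈p , there a∈) = proj₁ (All.lookup outside a∈p) (Pe-tail e-in a∈)

        classify : ∀ {a} → a ∈ p ⊎ a ∈ e ∷ edges (Pe e) →
          (a ∈ edges (P i) × ¬ T (tail a) × (T (head a) → a ≡ e)) ⊎ a ∈ edges (Pe e)
        classify (inj₁ a∈p) =
          let ¬Ttail , ¬Thead = All.lookup outside a∈p
          in inj₁ (prefix⊆ w p eq a∈p , ¬Ttail , λ Thead → contradiction Thead ¬Thead)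
        classify (inj₂ (here refl)) = inj₁ (e∈arcs w p eq , proj₁ e-in , λ _ → refl)
        classify (inj₂ (there a∈)) = inj₂ a∈

      I''∃ : ∃ λ J → B ⊆ J × IsBaseOf (B ∪ Iout) J
      I''∃ = indep-max B (B ∪ Iout) (proj₁ (proj₂ B-base)) inj₁

      I'' : Pred S 0ℓ
      I'' = proj₁ I''∃

      B⊆I'' : B ⊆ I''
      B⊆I'' = proj₁ (proj₂ I''∃)

      I''-base : IsBaseOf (B ∪ Iout) I''
      I''-base = proj₂ (proj₂ I''∃)

      I''-indep : Indep I''
      I''-indep = proj₁ (proj₂ I''-base)

      𝒮T⊆span : ∀ {J} → B ⊆ J → 𝒮 T ⊆ span J
      𝒮T⊆span B⊆J i∈ = span-mono B⊆J (base-spans B-base i∈)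

      I⊆span-I'' : I ⊆ span I''
      I⊆span-I'' {i} Ii with dec {𝒮 T i}
      ... | yes i∈ = 𝒮T⊆span B⊆I'' i∈
      ... | no i∉ = base-spans I''-base (inj₂ (Ii , i∉))

      abstract
        Q∃ : ∃ λ (Q : S → Trail) → ∀ i → I'' i → FromBase i (Q i) ⊎ FromOutside i (Q i)
        Q∃ = choose dec {R = λ i w → FromBase i w ⊎ FromOutside i w} stop λ i I''i →
          [ (λ Bi → let w , b = base-trail Bi in w , inj₁ b)
          , (λ o → let w , out = outside-trail o in w , inj₂ out) ]′ (proj₁ I''-base I''i)

      Q : S → Trail
      Q = proj₁ Q∃

      Q-kind : ∀ {i} → I'' i → FromBase i (Q i) ⊎ FromOutside i (Q i)
      Q-kind = proj₂ Q∃ _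

      base#outside : ∀ {i j a} → FromBase i (Q i) → FromOutside j (Q j) →
                     a ∈ arcs (Q i) → a ∈ arcs (Q j) → ⊥
      base#outside (Bi , _ , i⊆) (_ , _ , e , e-in , _ , _ , j⊆) a∈i a∈j with j⊆ a∈j
      ... | inj₁ (_ , ¬Ttail , _) = ¬Ttail (Pb-tail Bi (i⊆ a∈i))
      ... | inj₂ a∈Pe = Pb#Pe _ e Bi e-in _ (i⊆ a∈i) a∈Pe

      outside#outside : ∀ {i j a} → FromOutside i (Q i) → FromOutside j (Q j) →
                        a ∈ arcs (Q i) → a ∈ arcs (Q j) → i ≡ j
      outside#outside ((Ii , _) , _ , e , e-in , e∈ , _ , i⊆)
                      ((Ij , _) , _ , e' , e'-in , e'∈ , _ , j⊆) a∈i a∈j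
        with i⊆ a∈i | j⊆ a∈j
      ... | inj₁ (a∈Pi , _) | inj₁ (a∈Pj , _) = P-disjoint Ii Ij a∈Pi a∈Pj
      ... | inj₁ (_ , ¬Ttail , _) | inj₂ a∈ = contradiction (Pe-tail e'-in a∈) ¬Ttail
      ... | inj₂ a∈ | inj₁ (_ , ¬Ttail , _) = contradiction (Pe-tail e-in a∈) ¬Ttail
      ... | inj₂ a∈ | inj₂ a∈' with dec {e ≡ e'}
      -- A common entry edge already lies on both `P i` and `P j`.
      ...   | yes refl = P-disjoint Ii Ij e∈ e'∈
      ...   | no e≢e' = ⊥-elim (Pe#Pe e e' e-in e'-in e≢e' _ a∈ a∈')

      Q-linkage : IsTrailLinkage I'' Q
      Q-linkage = rooted , disjoint
        where
        rooted : ∀ {i} → I'' i → π i (src (Q i))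
        rooted I''i with Q-kind I''i
        ... | inj₁ (Bi , s , _) = subst (π _) (sym s) (proj₁ (Pb-ok _ Bi))
        ... | inj₂ ((Ii , _) , s , _) = subst (π _) (sym s) (proj₁ (proj₁ link _ Ii))

        disjoint : ∀ {i j a} → I'' i → I'' j → a ∈ arcs (Q i) → a ∈ arcs (Q j) → i ≡ j
        disjoint {i} {j} {a} I''i I''j a∈i a∈j with Q-kind I''i | Q-kind I''j
        ... | inj₁ b@(Bi , _ , i⊆) | inj₁ b'@(Bj , _ , j⊆) =
          decidable-stable dec λ i≢j → Pb#Pb i j Bi Bj i≢j a (i⊆ a∈i) (j⊆ a∈j)
        ... | inj₁ b | inj₂ o = ⊥-elim (base#outside b o a∈i a∈j)
        ... | inj₂ o | inj₁ b = ⊥-elim (base#outside b o a∈j a∈i)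
        ... | inj₂ o | inj₂ o' = outside#outside o o' a∈i a∈j

      spare-edge-state : ∀ {e} → inD T e → (∀ {i} → I'' i → ¬ e ∈ arcs (Q i)) → State
      spare-edge-state {e} e-in unused = record
        { Idx = I'' ; indep = I''-indep ; fam = Q ; extra = through e e-in
        ; linkage = Q-linkage ; extra# = separate }
        where
        separate : ∀ {i a} → I'' i → a ∈ arcs (Q i) → a ∈ e ∷ edges (Pe e) → ⊥
        separate I''i a∈i (here refl) = unused I''i a∈i
        separate I''i a∈i (there a∈) with Q-kind I''i
        ... | inj₁ (Bi , _ , i⊆) = Pb#Pe _ e Bi e-in _ (i⊆ a∈i) a∈
        ... | inj₂ (_ , _ , e' , e'-in , _ , e'∈ , i⊆) with i⊆ a∈i
        ...   | inj₁ (_ , ¬Ttail , _) = ¬Ttail (Pe-tail e-in a∈)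
        -- `e'` differs from `e`, since `e'` lies on a trail of the linkage and `e` on none.
        ...   | inj₂ a∈' = Pe#Pe e' e e'-in e-in (λ { refl → unused I''i e'∈ }) _ a∈' a∈

      -- Complementarity when all edges into `T` are used and the span has not grown.

      module Saturated (saturated : ∀ {e} → inD T e → ∃ λ i → I'' i × e ∈ arcs (Q i))
                       (spanned : span I'' ⊆ span I) where

        -- The tail of `e` is outside `T`, so `e` lies on none of the paths `Pb` and `Pe`. What
        -- remains is the initial part of a trail that follows some `P i`.
        owner : ∀ {e} → inD T e → ∃ λ i → I'' i × FromOutside i (Q i) × e ∈ arcs (Q i) ×
                e ∈ edges (P i)
        owner e-in@(¬Ttail , _) with saturated e-in
        ... | i , I''i , e∈ with Q-kind I''i
        ...   | inj₁ (Bi , _ , i⊆) = contradiction (Pb-tail Bi (i⊆ e∈)) ¬Ttail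
        ...   | inj₂ o@(_ , _ , e' , e'-in , _ , _ , i⊆) with i⊆ e∈
        ...     | inj₁ (e∈P , _) = i , I''i , o , e∈ , e∈P
        ...     | inj₂ e∈Pe = contradiction (Pe-tail e'-in e∈Pe) ¬Ttail

        owned : ∀ {i e} → I i → e ∈ edges (P i) → inD T e →
                I'' i × FromOutside i (Q i) × e ∈ arcs (Q i)
        owned Ii e∈ e-in with owner e-in
        ... | k , I''k , o , e∈Q , e∈k with P-disjoint Ii (proj₁ (proj₁ o)) e∈ e∈k
        ...   | refl = I''k , o , e∈Q

        -- The first edge of `P i` into `T` has an owner, which must be `i` because the paths `P`
        -- are disjoint.
        Iout⊆I'' : Iout ⊆ I''
        Iout⊆I'' {i} o@(Ii , _) =
          let p , e , q , eq , e-in , _ =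
                first-entry T (edges (P i)) (chain (P i)) (start∉T o) (end∈T Ii)
          in proj₁ (owned Ii (subst (e ∈_) (sym eq) (∈-++⁺ʳ p (here refl))) e-in)

        -- A new `j` in `𝒮 T` is spanned by `I''`, hence by `I`. If its circuit contained some `k`
        -- of `Iout`, then `I''` without `k` would span `I` with `k` exchanged for `j`, hence `k`,
        -- against the independence of `I''`. So the circuit consists of `j` and elements of
        -- `I ∩ 𝒮 T`.
        base : IsBaseOf (𝒮 T) (I ∩ 𝒮 T)
        base = proj₂ , indep-⊆ I _ proj₁ indI , λ J indJ Iin⊆J J⊆ {j} Jj →
          decidable-stable dec λ ¬Iin-j → absurd (J⊆ Jj) (λ Ij → ¬Iin-j (Ij , J⊆ Jj))
            (indep-⊆ J _ [ Iin⊆J , (λ { refl → Jj }) ] indJ)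
          where
          absurd : ∀ {j} → 𝒮 T j → ¬ I j → ¬ Indep ((I ∩ 𝒮 T) ∪ ｛ j ｝)
          absurd {j} j∈ ¬Ij ind = fundamental-circuit indI dep
            (indep-⊆ _ _ [ (λ (Ii , ind') → inj₁ (Ii , decidable-stable dec λ i∉ →
                             no-exchange (Ii , i∉) ind'))
                         , inj₂ ] ind)
            where
            dep : ¬ Indep (I ∪ ｛ j ｝)
            dep ind' = ¬Ij (span-∩-indep ind' inj₁ (inj₂ refl) (spanned (𝒮T⊆span B⊆I'' j∈)))

            no-exchange : ∀ {k} → Iout k → ¬ Indep ((I ∖ ｛ k ｝) ∪ ｛ j ｝)
            no-exchange {k} o@(Ik , k∉) ind' =
              proj₂ (span-∩-indep I''-indep proj₁ (Iout⊆I'' o)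
                (span-closed ind'' sub (exchange-spans ind' dep Ik))) refl
              where
              ind'' : Indep (I'' ∖ ｛ k ｝)
              ind'' = indep-⊆ I'' _ proj₁ I''-indep

              B⊆ : B ⊆ I'' ∖ ｛ k ｝
              B⊆ Bb = B⊆I'' Bb , λ { refl → k∉ (proj₁ B-base Bb) }

              sub : (I ∖ ｛ k ｝) ∪ ｛ j ｝ ⊆ span (I'' ∖ ｛ k ｝)
              sub (inj₂ refl) = 𝒮T⊆span B⊆ j∈
              sub {x} (inj₁ (Ix , k≢x)) with dec {𝒮 T x}
              ... | yes x∈ = 𝒮T⊆span B⊆ x∈
              ... | no x∉ = inj₁ (Iout⊆I'' (Ix , x∉) , k≢x)

        complementary : Complementarity I P T
        complementary = base , inner , crossing , covered
          where
          -- Going back from the end in `T`, an edge of `P i` that enters `T` would be owned by `i`,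
          -- and owners are in `Iout`.
          inner : ∀ i → I i → 𝒮 T i → InInduced T (P i)
          inner i Ii i∈ = backward-closed (chain (P i)) (end∈T Ii) λ a∈ Th →
            decidable-stable dec λ ¬Ttail →
              let _ , ((_ , i∉) , _) , _ = owned Ii a∈ (¬Ttail , Th) in i∉ i∈

          -- Each edge at which `P i` enters `T` is used by `Q i`, and `Q i` enters `T` only through
          -- `e`.
          crossing : ∀ i → I i → ¬ 𝒮 T i → ∃ λ a → a ∈ edges (P i) × inD T a ×
                     (∀ a' → a' ∈ edges (P i) → inD T a' → a' ≡ a)
          crossing i Ii i∉ with Q-kind (Iout⊆I'' (Ii , i∉))
          ... | inj₁ (Bi , _) = contradiction (proj₁ B-base Bi) i∉
          ... | inj₂ (_ , _ , e , e-in , e∈ , _ , i⊆) = e , e∈ , e-in , unique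
            where
            unique : ∀ a' → a' ∈ edges (P i) → inD T a' → a' ≡ e
            unique a' a'∈ a'-in with i⊆ (proj₂ (proj₂ (owned Ii a'∈ a'-in)))
            ... | inj₁ (_ , _ , only) = only (proj₂ a'-in)
            ... | inj₂ a'∈Pe = contradiction (Pe-tail e-in a'∈Pe) (proj₁ a'-in)

          covered : ∀ e → inD T e → ∃ λ i → I i × ¬ 𝒮 T i × e ∈ edges (P i)
          covered e e-in = let i , _ , ((Ii , i∉) , _) , _ , e∈ = owner e-in in i , Ii , i∉ , e∈

      improve : ¬ Complementarity I P T →
                Σ (Pred S 0ℓ) λ I' → Indep I' × Linkable I' ｛ t ｝ × span I ⊂ span I'
      improve ¬comp with em {span I'' ⊆ span I}
      ... | no larger = I'' , I''-indep , trailLinkage⇒linkable Q Q-linkage ,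
                        span-closed I''-indep I⊆span-I'' , larger
      ... | yes spanned with dec {∃ λ e → inD T e × (∀ {i} → I'' i → ¬ e ∈ arcs (Q i))}
      ...   | no none = contradiction (Saturated.complementary saturated spanned) ¬comp
        where
        saturated : ∀ {e} → inD T e → ∃ λ i → I'' i × e ∈ arcs (Q i)
        saturated e-in = decidable-stable dec λ unowned →
          none (_ , e-in , λ I''i e∈ → unowned (_ , I''i , e∈))
      ...   | yes (e , e-in , unused) with augment-or-good (spare-edge-state e-in unused)
      -- The initial source is `tail e`, which maximality would force into `T`.
      ...     | inj₂ (Z , Z-good , tail∈Z) = contradiction (proj₂ largest Z Z-good tail∈Z) (proj₁ e-in)
      ...     | inj₁ (I' , indI' , linkable , I''⊆I' , I'⊈I'') =
        I' , indI' , linkable ,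
        (λ x∈ → I''⊆I' (span-closed I''-indep I⊆span-I'' x∈)) ,
        (λ I'⊆I → I'⊈I'' (λ x∈ → span-closed I''-indep I⊆span-I'' (I'⊆I x∈)))

mainTheorem4 : ExcludedMiddle (suc 0ℓ) →
    (R : MatroidRootedDigraph) →
    let open MatroidRootedDigraph R in
    (t : V) (T : Pred V 0ℓ) → IsLargestGood t T →
    (I : Pred S 0ℓ) → Indep I →
    (P : S → Path) → IsLinkage I ｛ t ｝ P →
    ¬ Complementarity I P T →
    Σ (Pred S 0ℓ) λ I' → Indep I' × Linkable I' ｛ t ｝ × span I ⊂ span I'
mainTheorem4 em R t T largest@((B , base , Pb , Pe , ok , ok' , bb , ee , be) , _) I indI P link =
  improve
  where
  open Augmentation em R t
  open AtLargestGood T largest I indI P link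
  open Rerouting B base Pb Pe ok ok' bb ee be
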